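{- Let $m\in\mathbb{N}$. Suppose that every induced subgraph of every split-prime graph on at most $m$ vertices is path-extremal. Then every graph in $\mathcal{C}_{\le m}$ is path-extremal, where $\mathcal{C}_{\le m}$ is the class of connected graphs whose canonical split decomposition has exactly one prime bag, that prime bag having size at most $m$ (the size of a bag is the number of vertices of its label graph).
   Context: All graphs are finite, simple and undirected; $P_n$ is the path on $n$ vertices. Zero forcing: given $S\subseteq V(G)$, color $S$ blue and the other vertices white. If a blue vertex has exactly one white neighbor, it forces that neighbor to become blue. Apply this rule repeatedly until no further force is possible. $S$ is a zero forcing set if all vertices end up blue. $z(G;k)$ is the number of zero forcing sets of $G$ of size $k$. A graph $G$ on $n$ vertices is path-extremal if $z(G;k)\le z(P_n;k)$ for all $0\le k\le n$. A split of a connected graph $G$ is a partition $(A,B)$ of $V(G)$ with $|A|,|B|\ge 2$ for which there are nonempty $A_1\subseteq A$, $B_1\subseteq B$ such that for all $a\in A$, $b\in B$: $ab\in E(G)$ iff $a\in A_1$ and $b\in B_1$. A connected graph is split-prime if it has no split and is neither a clique nor a star. Graph-labelled trees: a graph-labelled-tree representation of a connected graph $G$ is a tree $T$ whose nodes, called bags, each carry a connected label graph. Each tree edge $BB'$ corresponds to one vertex of the label of $B$ and one vertex of the label of $B'$, called marker vertices; different tree edges at a bag correspond to different markers. All non-marker vertices of the labels are ordinary vertices, and the ordinary vertices (over all bags) are exactly the vertices of $G$. Adjacency in $G$ is given by accessibility: two ordinary vertices in the same bag are adjacent in $G$ iff they are adjacent in its label; ordinary vertices $u,v$ in distinct bags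 $B_0,B_t$, joined by the tree path $B_0,B_1,\dots,B_t$, are adjacent in $G$ iff $u$ is adjacent in $B_0$ to the marker for $B_0B_1$, for each $1\le i\le t-1$ the markers of $B_i$ for $B_{i-1}B_i$ and $B_iB_{i+1}$ are adjacent in $B_i$, and the marker of $B_t$ for $B_{t-1}B_t$ is adjacent to $v$ in $B_t$. The representation is reduced (standard sense of split decomposition) if each label is a clique with at least three vertices (clique bag), a star with at least three vertices (star bag), or a split-prime graph (prime bag); no tree edge joins two clique bags; and no tree edge joins two star bags such that its marker is a leaf of one star and the center of the other. The canonical split decomposition of $G$ is its (unique up to isomorphism) reduced graph-labelled-tree representation. -}

module Defs where

open import Data.Bool.Base using (Bool; T)
open import Data.Fin.Base using (Fin; toℕ)
open import Data.Fin.Properties as Fin using (any?; all?)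
open import Data.Fin.Subset
  using (Subset; inside; outside; _∈_; _∉_; _⊆_; _⊃_; _∪_; ∁; ⁅_⁆; ⊤; ∣_∣; Nonempty)
open import Data.Fin.Subset.Induction using (Acc; acc; ⊃-wellFounded)
open import Data.Fin.Subset.Properties
  using (_∈?_; p⊆p∪q; q⊆p∪q; x∈⁅x⁆)
open import Data.Bool.Properties as Bool using (T?)
open import Data.List.Base using (List; []; _∷_; _++_; map; filter; length)
open import Data.List.Relation.Unary.Unique.Propositional using (Unique)
open import Data.Nat.Base using (ℕ; zero; suc; _≤_; _<_)
open import Data.Nat.Properties as ℕ using (1+n≢n)
open import Data.Product.Base using (Σ; ∃-syntax; _×_; _,_; proj₁; proj₂)
open import Data.Sum.Base using (_⊎_; inj₁; inj₂; swap)
open import Data.Vec.Base as Vec using ()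
open import Data.Vec.Properties as Vec using (≡-dec)
open import Function.Bundles using (_⇔_; _↣_; module Injection)
open import Function.Definitions using (Injective)
open import Relation.Binary.Construct.Closure.ReflexiveTransitive
  using (Star; ε; _◅_)
open import Relation.Binary.Definitions using (Symmetric; Decidable)
open import Relation.Binary.PropositionalEquality
  using (_≡_; _≢_; refl)
open import Relation.Nullary using (¬_; Dec; yes; no)
open import Relation.Nullary.Decidable
  using (⌊_⌋; toWitness; fromWitness; _×-dec_; _⊎-dec_; _→-dec_; ¬?)

record Graph (n : ℕ) : Set where
  field
    adj : Fin n → Fin n → Bool

  infix 4 _~_
  _~_ : Fin n → Fin n → Set
  u ~ v = T (adj u v)

  field
    ~-sym    : Symmetric _~_
    ~-irrefl : ∀ {v} → ¬ (v ~ v)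

  _~?_ : Decidable _~_
  u ~? v = T? (adj u v)

open Graph using (adj)

private
  variable
    n k : ℕ

infix 4 adjacent
adjacent : (G : Graph n) → Fin n → Fin n → Set
adjacent G = Graph._~_ G
syntax adjacent G u v = u ~[ G ] v

fromDecidable : {E : Fin n → Fin n → Set} → Decidable E → Symmetric E →
                (∀ {v} → ¬ E v v) → Graph n
fromDecidable E? E-sym E-irrefl = record
  { adj      = λ u v → ⌊ E? u v ⌋
  ; ~-sym    = λ {u} {v} e →
      fromWitness {a? = E? v u} (E-sym (toWitness {a? = E? u v} e))
  ; ~-irrefl = λ {v} e → E-irrefl (toWitness {a? = E? v v} e)
  }

Consecutive : Fin n → Fin n → Set
Consecutive i j = suc (toℕ i) ≡ toℕ j ⊎ suc (toℕ j) ≡ toℕ i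

pathGraph : ∀ n → Graph n
pathGraph n = fromDecidable {E = Consecutive}
  (λ i j → (suc (toℕ i) ℕ.≟ toℕ j) ⊎-dec (suc (toℕ j) ℕ.≟ toℕ i))
  swap
  (λ { (inj₁ p) → 1+n≢n p ; (inj₂ p) → 1+n≢n p })

-- The subgraph of G induced by the image of f, with vertices named through f.
induced : Graph n → Fin k ↣ Fin n → Graph k
induced G f = record
  { adj      = λ u v → adj G (to u) (to v)
  ; ~-sym    = Graph.~-sym G
  ; ~-irrefl = Graph.~-irrefl G
  }
  where open Injection f using (to)

Walk : Graph n → Fin n → Fin n → Set
Walk G = Star (adjacent G)

visited : (G : Graph n) {u v : Fin n} → Walk G u v → List (Fin n)
visited G {u} ε       = u ∷ []
visited G {u} (_ ◅ p) = u ∷ visited G p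

IsPath : (G : Graph n) {u v : Fin n} → Walk G u v → Set
IsPath G p = Unique (visited G p)

Connected : Graph n → Set
Connected {n} G = 0 < n × (∀ u v → Walk G u v)

-- A cycle is a path on at least three vertices whose ends are adjacent.
Acyclic : Graph n → Set
Acyclic G = ∀ {u v} (p : Walk G u v) → IsPath G p →
            3 ≤ length (visited G p) → ¬ (v ~[ G ] u)

IsTree : Graph n → Set
IsTree G = Connected G × Acyclic G

-- S is the current set of blue vertices.
Forces : Graph n → Subset n → Fin n → Fin n → Set
Forces G S u v = u ∈ S × v ∉ S × u ~[ G ] v ×
                 (∀ w → u ~[ G ] w → w ∉ S → w ≡ v)

ForceStep : Graph n → Subset n → Subset n → Set
ForceStep G S S′ = ∃[ u ] ∃[ v ] Forces G S u v × S′ ≡ S ∪ ⁅ v ⁆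

-- The final blue set does not depend on the order of the forces, so it is ⊤
-- exactly when some sequence of forces reaches ⊤.
ZeroForcing : Graph n → Subset n → Set
ZeroForcing G S = Star (ForceStep G) S ⊤

forces? : ∀ (G : Graph n) S u v → Dec (Forces G S u v)
forces? G S u v =
  (u ∈? S) ×-dec ¬? (v ∈? S) ×-dec (u ~? v) ×-dec
  all? (λ w → (u ~? w) →-dec (¬? (w ∈? S) →-dec (w Fin.≟ v)))
  where open Graph G

zeroForcing? : ∀ (G : Graph n) S → Dec (ZeroForcing G S)
zeroForcing? {n} G S = go S (⊃-wellFounded S)
  where
  go : ∀ S → Acc _⊃_ S → Dec (ZeroForcing G S)
  go S (acc rec) with Vec.≡-dec Bool._≟_ S ⊤
  ... | yes refl = yes ε
  ... | no  S≢⊤ with any? (λ u → any? (λ v → forceThenWin? u v))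
    where
    grow : ∀ {v} → v ∉ S → (S ∪ ⁅ v ⁆) ⊃ S
    grow {v} v∉S =
      p⊆p∪q ⁅ v ⁆ , v , q⊆p∪q S ⁅ v ⁆ (x∈⁅x⁆ v) , v∉S

    forceThenWin? : ∀ u v → Dec (Forces G S u v × ZeroForcing G (S ∪ ⁅ v ⁆))
    forceThenWin? u v with forces? G S u v
    ... | no ¬f = no λ (f , _) → ¬f f
    ... | yes f with go (S ∪ ⁅ v ⁆) (rec (grow (proj₁ (proj₂ f))))
    ...   | yes z = yes (f , z)
    ...   | no ¬z = no λ (_ , z) → ¬z z
  ...   | yes (u , v , f , z) = yes ((u , v , f , refl) ◅ z)
  ...   | no ¬win = no λ
    { ε → S≢⊤ refl
    ; ((u , v , f , refl) ◅ z) → ¬win (u , v , f , z) }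

subsets : ∀ n → List (Subset n)
subsets zero    = Vec.[] ∷ []
subsets (suc n) = map (outside Vec.∷_) (subsets n) ++ map (inside Vec.∷_) (subsets n)

z : Graph n → ℕ → ℕ
z {n} G k = length
  (filter (λ S → (∣ S ∣ ℕ.≟ k) ×-dec zeroForcing? G S) (subsets n))

PathExtremal : Graph n → Set
PathExtremal {n} G = ∀ k → k ≤ n → z G k ≤ z (pathGraph n) k

record Split (G : Graph n) : Set where
  field
    A A₁ B₁ : Subset n

  B : Subset n
  B = ∁ A

  field
    2≤∣A∣       : 2 ≤ ∣ A ∣
    2≤∣B∣       : 2 ≤ ∣ B ∣
    A₁⊆A        : A₁ ⊆ A
    B₁⊆B        : B₁ ⊆ B
    A₁-nonempty : Nonempty A₁
    B₁-nonempty : Nonempty B₁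
    crossing    : ∀ {a b} → a ∈ A → b ∈ B → a ~[ G ] b ⇔ (a ∈ A₁ × b ∈ B₁)

IsClique : Graph n → Set
IsClique G = ∀ {u v} → u ≢ v → u ~[ G ] v

IsCentre : Graph n → Fin n → Set
IsCentre G c = ∀ u v → u ~[ G ] v ⇔ (u ≢ v × (u ≡ c ⊎ v ≡ c))

IsStar : Graph n → Set
IsStar G = ∃[ c ] IsCentre G c

IsLeaf : Graph n → Fin n → Set
IsLeaf G x = ∃[ c ] IsCentre G c × x ≢ c

SplitPrime : Graph n → Set
SplitPrime G = Connected G × ¬ Split G × ¬ IsClique G × ¬ IsStar G

record GraphLabelledTree : Set where
  field
    bags   : ℕ
    tree   : Graph bags
    isTree : IsTree tree

    size            : Fin bags → ℕ
    label           : ∀ B → Graph (size B)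
    label-connected : ∀ B → Connected (label B)

    -- marker e, for e : B ~ B′, is the marker in B (the source of e); the
    -- one in B′ is the marker of the reversed edge.
    marker           : ∀ {B B′} → B ~[ tree ] B′ → Fin (size B)
    marker-injective : ∀ {B B′ B″} (e : B ~[ tree ] B′) (f : B ~[ tree ] B″) →
                       marker e ≡ marker f → B′ ≡ B″

  opposite : ∀ {B B′} → B ~[ tree ] B′ → Fin (size B′)
  opposite e = marker (Graph.~-sym tree e)

  Ordinary : ∀ B → Fin (size B) → Set
  Ordinary B x = ∀ {B′} (e : B ~[ tree ] B′) → x ≢ marker e

  -- On the walk B₀ B₁ … B_t the adjacencies required are x to the marker for
  -- B₀B₁, then between the two markers inside each Bᵢ, then marker to y; on
  -- the trivial walk it is x to y in the common bag.
  Accessible : ∀ {B C} → Fin (size B) → Walk tree B C → Fin (size C) → Set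
  Accessible {B} x ε       y = x ~[ label B ] y
  Accessible {B} x (e ◅ p) y = x ~[ label B ] marker e × Accessible (opposite e) p y

record Represents (R : GraphLabelledTree) (G : Graph n) : Set where
  open GraphLabelledTree R
  field
    -- A bijection from the vertices of G to the ordinary vertices.
    bag             : Fin n → Fin bags
    place           : ∀ v → Fin (size (bag v))
    place-ordinary  : ∀ v → Ordinary (bag v) (place v)
    place-injective : Injective {A = Fin n} {B = Σ (Fin bags) (λ B → Fin (size B))}
                        _≡_ _≡_ (λ v → bag v , place v)
    place-covers    : ∀ B x → Ordinary B x → ∃[ v ] (bag v , place v) ≡ (B , x)

    accessibility   : ∀ u v (p : Walk tree (bag u) (bag v)) → IsPath tree p →
                      u ~[ G ] v ⇔ Accessible (place u) p (place v)

module _ (R : GraphLabelledTree) where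
  open GraphLabelledTree R

  CliqueBag StarBag PrimeBag : Fin bags → Set
  CliqueBag B = 3 ≤ size B × IsClique (label B)
  StarBag   B = 3 ≤ size B × IsStar (label B)
  PrimeBag  B = SplitPrime (label B)

  record Reduced : Set where
    field
      bag-kinds      : ∀ B → CliqueBag B ⊎ StarBag B ⊎ PrimeBag B
      no-clique-join : ∀ {B B′} → B ~[ tree ] B′ → ¬ (CliqueBag B × CliqueBag B′)
      no-star-join   : ∀ {B B′} (e : B ~[ tree ] B′) → StarBag B → StarBag B′ →
                       ¬ (IsLeaf (label B) (marker e) × IsCentre (label B′) (opposite e))

-- The canonical split decomposition is unique up to isomorphism, so a property
-- of it is stated of some reduced representation.
record InClass (m : ℕ) (G : Graph n) : Set where
  field
    connected      : Connected G
    decomposition  : GraphLabelledTree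
    represents     : Represents decomposition G
    reduced        : Reduced decomposition

  open GraphLabelledTree decomposition using (bags; size)

  field
    prime          : Fin bags
    prime-is-prime : PrimeBag decomposition prime
    prime-unique   : ∀ B → PrimeBag decomposition B → B ≡ prime
    prime-size     : size prime ≤ m

{-# OPTIONS --safe #-}
module Submission where

-- Call a set of vertices failing if it is not zero forcing; path-extremality says that
-- G has at least as many failing k-sets as the path. On the path these are the sparse
-- sets, avoiding the ends and any two consecutive vertices; their number c(n,k)
-- satisfies c(n,k) ≤ c(n-1,k) + c(n-2,k-1).
--
-- By induction on size, every induced subgraph H of G has at least c(∣H∣,k) failing
-- k-sets. If H has an isolated vertex or two twins, all sets avoiding them fail, and
-- c(n,k) is at most the number of k-subsets avoiding one or two given vertices. If x is
-- a leaf of H attached to y, the failing k-sets of H are at least as many as those of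
-- H - x together with the failing (k-1)-sets of H - x - y.
--
-- One of these cases arises unless H is an induced subgraph of the prime label. If two
-- vertices of H lie behind the same marker of the prime bag, walk away from it to a bag
-- beyond which several vertices of H lie, but at most one of them in each further
-- branch. At such a bag, a clique or a star, two of these vertices are twins, or one is
-- a leaf attached to another, or one is isolated. Otherwise the vertices of H have
-- distinct representatives in the prime label, and either one of them is isolated or
-- this is an embedding.

open import Defs
open import Data.Bool.Base using (true; false)
open import Data.Bool.Properties using (T-irrelevant)
open import Data.Fin.Base using (Fin; zero; suc; toℕ; fromℕ; punchIn; punchOut)
open import Data.Fin.Properties as Fin
  using (any?; punchIn-injective; punchInᵢ≢i; punchIn-punchOut; toℕ-injective)
open import Data.Fin.Subset
  using (Subset; Side; inside; outside; _∈_; _∉_; _⊆_; _⊃_; _∪_; ⁅_⁆; ∣_∣)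
  renaming (⊤ to full)
open import Data.Fin.Subset.Induction using (Acc; acc; ⊃-wellFounded)
open import Data.Fin.Subset.Properties
  using (_∈?_; p⊆p∪q; q⊆p∪q; x∈⁅x⁆; x∈⁅y⁆⇒x≡y; x∈p∪q⁻; ∈⊤; ∣p∣≤n; drop-there)
open import Data.List.Base as List using (List; []; _∷_; _++_; length; filter)
open import Data.List.Membership.Propositional using () renaming (_∈_ to _∈ˡ_)
open import Data.List.Properties using (length-++; filter-++; filter-none)
open import Data.List.Relation.Binary.Sublist.Propositional using (⊆-refl)
open import Data.List.Relation.Binary.Sublist.Propositional.Properties using (filter⁺; length-mono-≤)
open import Data.List.Relation.Unary.All as All using (All; []; _∷_)
open import Data.List.Relation.Unary.All.Properties using (¬Any⇒All¬)
open import Data.List.Relation.Unary.AllPairs using ([]; _∷_)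
open import Data.List.Relation.Unary.Any using () renaming (here to hereˡ; there to thereˡ)
open import Data.Nat.Base using (ℕ; zero; suc; _+_; _⊔_; _≤_; z≤n; s≤s; s≤s⁻¹)
open import Data.Nat.Properties as ℕ
  using (≤-refl; ≤-reflexive; ≤-trans; m≤m⊔n; m≤n⊔m; m≤m+n; +-mono-≤; +-comm; +-assoc; +-suc; suc-injective)
open import Data.Product.Base using (∃-syntax; Σ-syntax; _×_; _,_; proj₁; proj₂)
open import Data.Sum.Base using (_⊎_; inj₁; inj₂)
open import Data.Unit.Base using (⊤; tt)
open import Data.Vec.Base using ([]; _∷_; lookup; insertAt; here; there)
open import Data.Vec.Properties using (insertAt-lookup; insertAt-punchIn; []=⇒lookup; lookup⇒[]=)
open import Function.Base using (_∘_)
open import Function.Bundles using (_⇔_; _↣_; mk⇔; mk↣; module Injection; module Equivalence)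
open import Function.Construct.Composition using (_↣-∘_)
open import Function.Construct.Identity using (↣-id)
open import Level using (0ℓ)
open import Relation.Binary.Construct.Closure.ReflexiveTransitive using (ε; _◅_)
open import Relation.Binary.PropositionalEquality
open import Relation.Nullary using (¬_; Dec; yes; no; does; contradiction)
open import Relation.Nullary.Decidable
  using (_×-dec_; ¬?; toWitness; fromWitness; decidable-stable; map′)
open import Relation.Unary using (Pred; Decidable)

-- Descent in the decomposition tree

-- In each case the bound by sparse sets can be proved for `H`: directly in the first two, from two
-- smaller graphs in the third. Twins may be adjacent or not.
data Reducible {k : ℕ} (H : Graph k) : Set where
  isolated : ∀ u → (∀ v → ¬ (u ~[ H ] v)) → Reducible H
  twins    : ∀ {u v} → u ≢ v →
             (∀ {w} → w ≢ u → w ≢ v → u ~[ H ] w ⇔ v ~[ H ] w) → Reducible H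
  pendant  : ∀ {x y} → x ~[ H ] y → (∀ {v} → x ~[ H ] v → v ≡ y) → Reducible H

bounded : ∀ {k} (h : Fin k → ℕ) → ∃[ d ] (∀ i → h i ≤ d)
bounded {zero}  h = zero , λ ()
bounded {suc k} h =
  let d , h≤d = bounded (λ i → h (suc i))
  in h zero ⊔ d , λ { zero → m≤m⊔n _ d ; (suc i) → ≤-trans (h≤d i) (m≤n⊔m (h zero) d) }

module _ {b : ℕ} {T : Graph b} where

  takeUntil : ∀ {B C D} (p : Walk T B C) → D ∈ˡ visited T p → Walk T B D
  takeUntil ε       (hereˡ refl) = ε
  takeUntil (e ◅ p) (hereˡ refl) = ε
  takeUntil (e ◅ p) (thereˡ m)   = e ◅ takeUntil p m

  All-takeUntil : ∀ {P : Fin b → Set} {B C D} (p : Walk T B C) (m : D ∈ˡ visited T p) →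
                  All P (visited T p) → All P (visited T (takeUntil p m))
  All-takeUntil ε       (hereˡ refl) ps       = ps
  All-takeUntil (e ◅ p) (hereˡ refl) (q ∷ ps) = q ∷ []
  All-takeUntil (e ◅ p) (thereˡ m)   (q ∷ ps) = q ∷ All-takeUntil p m ps

  IsPath-takeUntil : ∀ {B C D} (p : Walk T B C) (m : D ∈ˡ visited T p) →
                     IsPath T p → IsPath T (takeUntil p m)
  IsPath-takeUntil ε       (hereˡ refl) ps       = ps
  IsPath-takeUntil (e ◅ p) (hereˡ refl) ps       = [] ∷ []
  IsPath-takeUntil (e ◅ p) (thereˡ m)   (q ∷ ps) =
    All-takeUntil p m q ∷ IsPath-takeUntil p m ps

module Decomposition {n : ℕ} {G : Graph n} {R : GraphLabelledTree} (rep : Represents R G) where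
  open GraphLabelledTree R
  open Represents rep

  sym-edge : ∀ {B C} → B ~[ tree ] C → C ~[ tree ] B
  sym-edge = Graph.~-sym tree

  marker-unique : ∀ {B C} (e e′ : B ~[ tree ] C) → marker e ≡ marker e′
  marker-unique e e′ = cong marker (T-irrelevant e e′)

  -- `x` records how the walk came to `B`: as the marker of the edge just used, or as an ordinary
  -- vertex at the start. Leaving through another vertex of the label means not turning back.
  NonBacktracking : ∀ {B C} → Fin (size B) → Walk tree B C → Set
  NonBacktracking x ε       = ⊤
  NonBacktracking x (e ◅ p) = x ≢ marker e × NonBacktracking (opposite e) p

  nonBacktracking-takeUntil : ∀ {B C D x} (p : Walk tree B C) (m : D ∈ˡ visited tree p) →
    NonBacktracking x p → NonBacktracking x (takeUntil p m)
  nonBacktracking-takeUntil ε       (hereˡ refl) nb        = nb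
  nonBacktracking-takeUntil (e ◅ p) (hereˡ refl) nb        = tt
  nonBacktracking-takeUntil (e ◅ p) (thereˡ m)   (≢e , nb) =
    ≢e , nonBacktracking-takeUntil p m nb

  -- With `e` such a path would close a loop (length 0), turn straight back along `e` (length 1), or
  -- form a cycle in the tree (length at least 2).
  no-return : ∀ {B C} (e : B ~[ tree ] C) (p : Walk tree C B) →
              NonBacktracking (opposite e) p → ¬ IsPath tree p
  no-return e ε                   nb       _ = Graph.~-irrefl tree e
  no-return e (e₁ ◅ ε)            (≢e₁ , _) _ = ≢e₁ (marker-unique _ _)
  no-return e p@(_ ◅ _ ◅ ε)       nb path = proj₂ isTree p path (s≤s (s≤s (s≤s z≤n))) e
  no-return e p@(_ ◅ _ ◅ _ ◅ _)   nb path = proj₂ isTree p path (s≤s (s≤s (s≤s z≤n))) e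

  -- If `B` occurred again in `p`, cutting `p` there would leave a path that `no-return` excludes.
  nonBacktracking-isPath : ∀ {B C x} (p : Walk tree B C) → NonBacktracking x p → IsPath tree p
  nonBacktracking-isPath ε       nb = [] ∷ []
  nonBacktracking-isPath {B} (e ◅ p) (_ , nb) = ¬Any⇒All¬ _ B∉p ∷ path
    where
    path : IsPath tree p
    path = nonBacktracking-isPath p nb

    B∉p : ¬ (B ∈ˡ visited tree p)
    B∉p m = no-return e (takeUntil p m)
      (nonBacktracking-takeUntil p m nb) (IsPath-takeUntil p m path)

  nonBacktracking-moves : ∀ {B C D} (e : B ~[ tree ] C) (p : Walk tree C D) →
                          NonBacktracking (opposite e) p → B ≢ D
  nonBacktracking-moves e p nb refl = no-return e p nb (nonBacktracking-isPath p nb)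

  -- The non-backtracking walks from the bag of u; π is the vertex of the last
  -- label that stands for u, namely u itself or the marker last entered through.
  mutual
    data Reach (u : Fin n) : Fin bags → Set where
      here : Reach u (bag u)
      step : ∀ {B C} (r : Reach u B) (e : B ~[ tree ] C) → π r ≢ marker e → Reach u C

    π : ∀ {u B} → Reach u B → Fin (size B)
    π {u} here     = place u
    π (step _ e _) = opposite e

  len : ∀ {u B} → Reach u B → ℕ
  len here         = zero
  len (step r _ _) = suc (len r)

  -- Whether the label adjacencies needed along the walk, up to π r, are all present.
  Open : ∀ {u B} → Reach u B → Set
  Open here                     = ⊤
  Open (step {B} r e _) = Open r × π r ~[ label B ] marker e

  open? : ∀ {u B} (r : Reach u B) → Dec (Open r)
  open? here             = yes tt
  open? (step {B} r e _) = open? r ×-dec Graph._~?_ (label B) (π r) (marker e)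

  -- If `e` leads back where `r` came from, the last step of `r` is undone instead of extended. This
  -- cannot happen at the start, since an ordinary vertex is no marker.
  extend : ∀ {u B C} (r : Reach u B) (e : B ~[ tree ] C) → Σ[ q ∈ Reach u C ]
    ((π r ≢ marker e × π q ≡ opposite e) ⊎
     (π r ≡ marker e × π q ≢ opposite e × len r ≡ suc (len q)))
  extend r e with π r Fin.≟ marker e
  ... | no ≢e = step r e ≢e , inj₁ (≢e , refl)
  extend {u} here e | yes eq = contradiction eq (place-ordinary u e)
  extend (step r e′ ≢e′) e | yes eq with refl ← marker-injective (sym-edge e′) e eq =
    r , inj₂ (eq , (λ eq′ → ≢e′ (trans eq′ (marker-unique _ _))) , refl)

  -- The walk may be arbitrary, as connectedness supplies it: `extend` cancels every backtracking
  -- edge.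
  reach-along : ∀ {u B C} → Reach u B → Walk tree B C → Reach u C
  reach-along r ε       = r
  reach-along r (e ◅ p) = reach-along (proj₁ (extend r e)) p

  reach : ∀ u B → Reach u B
  reach u B = reach-along here (proj₂ (proj₁ isTree) (bag u) B)

  back : ∀ {v B} → Reach v B → Walk tree B (bag v)
  back here         = ε
  back (step q e _) = sym-edge e ◅ back q

  join : ∀ {u v B} → Reach u B → Walk tree B (bag v) → Walk tree (bag u) (bag v)
  join here         p = p
  join {v = v} (step r e _) p = join {v = v} r (e ◅ p)

  back-nonBacktracking : ∀ {v B} (q : Reach v B) {x : Fin (size B)} → x ≢ π q →
                         NonBacktracking x (back q)
  back-nonBacktracking here          x≢ = tt
  back-nonBacktracking (step q e ≢e) x≢ =
    x≢ , back-nonBacktracking q λ eq → ≢e (trans (sym eq) (marker-unique _ _))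

  join-nonBacktracking : ∀ {u v B} (r : Reach u B) (p : Walk tree B (bag v)) →
                         NonBacktracking (π r) p → NonBacktracking (place u) (join {v = v} r p)
  join-nonBacktracking here         p nb = nb
  join-nonBacktracking {v = v} (step r e ≢e) p nb =
    join-nonBacktracking {v = v} r (e ◅ p) (≢e , nb)

  back-accessible : ∀ {v B} (q : Reach v B) (x : Fin (size B)) →
    Accessible x (back q) (place v) ⇔ (Open q × x ~[ label B ] π q)
  back-accessible here x = mk⇔ (λ a → tt , a) proj₂
  back-accessible {v} {B} (step {A} q e _) x = mk⇔
    (λ (a , rest) →
      let oq , adj = to (back-accessible q (opposite (sym-edge e))) rest
      in (oq , Graph.~-sym (label A) (subst (λ m → m ~[ label A ] π q) flip-twice adj)) , a)
    (λ ((oq , adj) , a) →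
      a , from (back-accessible q (opposite (sym-edge e)))
            (oq , subst (λ m → m ~[ label A ] π q) (sym flip-twice) (Graph.~-sym (label A) adj)))
    where
    open Equivalence
    flip-twice : opposite (sym-edge e) ≡ marker e
    flip-twice = marker-unique _ _

  join-accessible : ∀ {u v B} (r : Reach u B) (p : Walk tree B (bag v)) →
    Accessible (place u) (join {v = v} r p) (place v) ⇔ (Open r × Accessible (π r) p (place v))
  join-accessible here p = mk⇔ (λ a → tt , a) proj₂
  join-accessible {v = v} (step r e _) p = mk⇔
    (λ a → let o , adj , rest = to (join-accessible {v = v} r (e ◅ p)) a in (o , adj) , rest)
    (λ ((o , adj) , rest) → from (join-accessible {v = v} r (e ◅ p)) (o , adj , rest))
    where open Equivalence

  -- Because the two reaches enter `B` at different vertices, `r` followed by the reverse of `q`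
  -- does not backtrack. It is thus the tree path on which accessibility is tested, and the test
  -- splits at `B`.
  adjacent⇔ : ∀ {u v B} (r : Reach u B) (q : Reach v B) → π r ≢ π q →
    u ~[ G ] v ⇔ (Open r × Open q × π r ~[ label B ] π q)
  adjacent⇔ {u} {v} r q ≢ = mk⇔
    (λ a → let o , a₁ = to joined (to access a) in o , to (back-accessible q (π r)) a₁)
    (λ (o , oq) → from access (from joined (o , from (back-accessible q (π r)) oq)))
    where
    open Equivalence
    joined = join-accessible {v = v} r (back q)
    access = accessibility u v (join {v = v} r (back q))
      (nonBacktracking-isPath _ (join-nonBacktracking {v = v} r (back q)
        (back-nonBacktracking q ≢)))

  last-step : ∀ {u B} (r : Reach u B) →
    (∃[ C ] Σ[ e ∈ C ~[ tree ] B ] π r ≡ opposite e × 1 ≤ len r) ⊎ (bag u , place u) ≡ (B , π r)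
  last-step here             = inj₂ refl
  last-step (step {C} r e _) = inj₁ (C , e , refl , s≤s z≤n)

  ordinary-image : ∀ {u B x} → (bag u , place u) ≡ (B , x) → Ordinary B x
  ordinary-image {u} refl = place-ordinary u

  -- A shared representative cannot be ordinary, since distinct vertices of `G` have distinct
  -- places. So it is a marker, and it names the branch into which to descend.
  collision : ∀ {u v B} (r : Reach u B) (q : Reach v B) → u ≢ v → π r ≡ π q →
              ∃[ C ] Σ[ e ∈ C ~[ tree ] B ] π r ≡ opposite e × 1 ≤ len r
  collision r q u≢v eq with last-step r | last-step q
  ... | inj₁ s  | _                      = s
  ... | inj₂ r₀ | inj₁ (_ , e , q≡ , _)  = contradiction (trans eq q≡) (ordinary-image r₀ (sym-edge e))
  ... | inj₂ r₀ | inj₂ q₀                =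
    contradiction (place-injective (trans r₀ (trans (cong (_ ,_) eq) (sym q₀)))) u≢v

  BasicBag : Fin bags → Set
  BasicBag B = IsClique (label B) ⊎ IsStar (label B)

  module Subgraph {k : ℕ} (f : Fin k ↣ Fin n) where
    open Injection f using (to; injective)

    -- Every other vertex has a representative different from that of `i`, so by `adjacent⇔` each
    -- edge at `i` would need the reach of `i` to be open.
    closed-isolated : ∀ {B} (ρ : ∀ i → Reach (to i) B) {i} →
      (∀ {w} → w ≢ i → π (ρ i) ≢ π (ρ w)) → ¬ Open (ρ i) → Reducible (induced G f)
    closed-isolated ρ {i} distinct ¬oi = isolated i λ w → case w (w Fin.≟ i)
      where
      case : ∀ w → Dec (w ≡ i) → ¬ (to i ~[ G ] to w)
      case w (yes refl) a = Graph.~-irrefl G a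
      case w (no w≢i)   a = ¬oi (proj₁ (Equivalence.to (adjacent⇔ (ρ i) (ρ w) (distinct w≢i)) a))

    -- The vertices of the subgraph that do not lie behind μ have pairwise distinct
    -- representatives in the label of B, and all see the rest through μ alone.
    reducible-at : ∀ {B} (ρ : ∀ i → Reach (to i) B) (μ : Fin (size B)) → BasicBag B →
      (∀ {i j} → π (ρ i) ≢ μ → π (ρ i) ≡ π (ρ j) → i ≡ j) →
      ∀ {i j} → i ≢ j → π (ρ i) ≢ μ → π (ρ j) ≢ μ → Reducible (induced G f)
    reducible-at {B} ρ μ basic inj {i₀} {j₀} i≢j i≢μ j≢μ = by-openness (open? (ρ i₀)) (open? (ρ j₀))
      where
      H : Graph k
      H = induced G f

      adj⇔ : ∀ {i w} → π (ρ i) ≢ μ → w ≢ i →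
             i ~[ H ] w ⇔ (Open (ρ i) × Open (ρ w) × π (ρ i) ~[ label B ] π (ρ w))
      adj⇔ {i} {w} i≢μ w≢i = adjacent⇔ (ρ i) (ρ w) λ eq → w≢i (sym (inj i≢μ eq))

      closed : ∀ {i} → π (ρ i) ≢ μ → ¬ Open (ρ i) → Reducible H
      closed i≢μ = closed-isolated ρ λ w≢i eq → w≢i (sym (inj i≢μ eq))

      -- With `i` at the centre of a star, `j` is at a leaf and sees only the centre. The centre is
      -- not `μ`, so it represents `i` alone.
      pendant-at : ∀ {i j} → i ≢ j → π (ρ j) ≢ μ → Open (ρ i) → Open (ρ j) →
                   IsCentre (label B) (π (ρ i)) → π (ρ i) ≢ μ → Reducible H
      pendant-at {i} {j} i≢j j≢μ oi oj centre i≢μ = pendant {x = j} {y = i}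
        (Equivalence.from (adj⇔ j≢μ i≢j)
          (oj , oi , Equivalence.from (centre _ _) ((λ eq → i≢j (sym (inj j≢μ eq))) , inj₂ refl)))
        λ {w} a → only w a (w Fin.≟ j)
        where
        only : ∀ w → j ~[ H ] w → Dec (w ≡ j) → w ≡ i
        only w a (yes refl) = contradiction a (Graph.~-irrefl H {w})
        only w a (no w≢j) with proj₂ (Equivalence.to (centre _ _)
                                 (proj₂ (proj₂ (Equivalence.to (adj⇔ j≢μ w≢j) a))))
        ... | inj₁ j-centre = contradiction (sym (inj j≢μ j-centre)) i≢j
        ... | inj₂ w-centre = sym (inj i≢μ (sym w-centre))

      twins-at : Open (ρ i₀) → Open (ρ j₀) →
        (∀ {y} → π (ρ i₀) ≢ y → π (ρ j₀) ≢ y →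
          π (ρ i₀) ~[ label B ] y ⇔ π (ρ j₀) ~[ label B ] y) → Reducible H
      twins-at oi oj same = twins i≢j λ {w} w≢i w≢j →
        let open Equivalence
            same-w = same {π (ρ w)} (λ eq → w≢i (sym (inj i≢μ eq))) (λ eq → w≢j (sym (inj j≢μ eq)))
        in mk⇔
          (λ a → let _ , o , l = to (adj⇔ i≢μ w≢i) a in from (adj⇔ j≢μ w≢j) (oj , o , to same-w l))
          (λ a → let _ , o , l = to (adj⇔ j≢μ w≢j) a in from (adj⇔ i≢μ w≢i) (oi , o , from same-w l))

      by-kind : BasicBag B → Open (ρ i₀) → Open (ρ j₀) → Reducible H
      by-kind (inj₁ clique) oi oj =
        twins-at oi oj λ i≢y j≢y → mk⇔ (λ _ → clique j≢y) (λ _ → clique i≢y)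
      by-kind (inj₂ (c , centre)) oi oj with π (ρ i₀) Fin.≟ c | π (ρ j₀) Fin.≟ c
      ... | yes refl | _        = pendant-at i≢j j≢μ oi oj centre i≢μ
      ... | no _     | yes refl = pendant-at (λ eq → i≢j (sym eq)) i≢μ oj oi centre j≢μ
      -- Two leaves of the star see exactly the centre. This covers the case that the centre is `μ`,
      -- behind which many vertices may lie.
      ... | no i≢c   | no j≢c   = twins-at oi oj λ i≢y j≢y →
        mk⇔ (λ a → Equivalence.from (centre _ _) (j≢y , inj₂ (leaf i≢c a)))
            (λ a → Equivalence.from (centre _ _) (i≢y , inj₂ (leaf j≢c a)))
        where
        leaf : ∀ {x y} → x ≢ c → x ~[ label B ] y → y ≡ c
        leaf x≢c a with proj₂ (Equivalence.to (centre _ _) a)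
        ... | inj₁ x≡c = contradiction x≡c x≢c
        ... | inj₂ y≡c = y≡c

      by-openness : Dec (Open (ρ i₀)) → Dec (Open (ρ j₀)) → Reducible H
      by-openness (no ¬oi) _        = closed i≢μ ¬oi
      by-openness (yes _)  (no ¬oj) = closed j≢μ ¬oj
      by-openness (yes oi) (yes oj) = by-kind basic oi oj

    module Descent (root : Fin bags) (basic : ∀ {B} → B ≢ root → BasicBag B) where

      mutual
        -- d bounds the distance to B from the vertices of the subgraph in the branch at B
        -- that avoids e.
        branch : ∀ d {B C} (e : B ~[ tree ] C) (p : Walk tree C root) →
          NonBacktracking (opposite e) p → (ρ : ∀ i → Reach (to i) B) →
          (∀ i → π (ρ i) ≢ marker e → len (ρ i) ≤ d) →
          ∀ {i j} → i ≢ j → π (ρ i) ≢ marker e → π (ρ j) ≢ marker e → Reducible (induced G f)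
        branch d e p nb ρ bound {i} {j} i≢j i≢e j≢e
          with any? (λ i → any? (λ j → ¬? (i Fin.≟ j) ×-dec ¬? (π (ρ i) Fin.≟ marker e) ×-dec
                                       (π (ρ i) Fin.≟ π (ρ j))))
        -- Two vertices share a further marker, so the search continues behind it, with `e`
        -- prepended to the walk back to the root.
        ... | yes (i′ , j′ , i′≢j′ , i′≢e , eq) =
          descend d (e ◅ p) ρ i′≢j′ eq (i′≢e , nb) λ l l≡i′ → bound l λ l≡e → i′≢e (trans (sym l≡i′) l≡e)
        ... | no none = reducible-at ρ (marker e) (basic (nonBacktracking-moves e p nb))
          (λ {i} {j} i≢e eq → decidable-stable (i Fin.≟ j) λ i≢j → none (i , j , i≢j , i≢e , eq))
          i≢j i≢e j≢e

        -- The marker shared by `i` and `j` belongs to an edge to a bag `C`; moving there shortens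
        -- by one the reach of every vertex behind it, so `d` decreases. The walk `p` is carried
        -- along to show that `C` is not the root and hence is basic.
        descend : ∀ d {B} (p : Walk tree B root) (ρ : ∀ i → Reach (to i) B) →
          ∀ {i j} → i ≢ j → π (ρ i) ≡ π (ρ j) → NonBacktracking (π (ρ i)) p →
          (∀ l → π (ρ l) ≡ π (ρ i) → len (ρ l) ≤ d) → Reducible (induced G f)
        descend d p ρ {i} {j} i≢j eq nb bound
          with collision (ρ i) (ρ j) (λ eq′ → i≢j (injective eq′)) eq
        -- A reach that ends at a marker has at least one step, against the bound zero.
        descend zero p ρ i≢j eq nb bound | C , e , i≡e , 1≤ with () ← ≤-trans 1≤ (bound _ refl)
        descend (suc d) p ρ {i} {j} i≢j eq nb bound | C , e , i≡e , _ =
          branch d e p (subst (λ x → NonBacktracking x p) i≡e nb) (λ l → proj₁ (moved l))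
            (λ l l≢ → s≤s⁻¹ (subst (_≤ suc d) (proj₂ (behind l l≢))
                               (bound l (trans (proj₁ (behind l l≢)) (sym i≡e)))))
            i≢j (inside-branch i i≡e) (inside-branch j (trans (sym eq) i≡e))
          where
          moved : ∀ l → Σ[ q ∈ Reach (to l) C ] _
          moved l = extend (ρ l) (sym-edge e)

          behind : ∀ l → π (proj₁ (moved l)) ≢ marker e →
                   π (ρ l) ≡ opposite e ×
                   len (ρ l) ≡ suc (len (proj₁ (moved l)))
          behind l l≢ with proj₂ (moved l)
          ... | inj₁ (_ , l≡)        = contradiction (trans l≡ (marker-unique _ _)) l≢
          ... | inj₂ (l≡ , _ , len≡) = l≡ , len≡

          inside-branch : ∀ l → π (ρ l) ≡ opposite e → π (proj₁ (moved l)) ≢ marker e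
          inside-branch l l≡ with proj₂ (moved l)
          ... | inj₁ (≢e , _)     = contradiction l≡ ≢e
          ... | inj₂ (_ , ≢ , _) = λ eq → ≢ (trans eq (marker-unique _ _))

      private
        ρ₀ : ∀ i → Reach (to i) root
        ρ₀ i = reach (to i) root

      embed : (∀ {i j} → π (ρ₀ i) ≡ π (ρ₀ j) → i ≡ j) → (∀ i → Open (ρ₀ i)) →
        Σ[ g ∈ Fin k ↣ Fin (size root) ]
          (∀ i j → i ~[ induced G f ] j ⇔ i ~[ induced (label root) g ] j)
      embed inj all-open = mk↣ inj , λ i j → same i j (i Fin.≟ j)
        where
        same : ∀ i j → Dec (i ≡ j) →
               to i ~[ G ] to j ⇔ π (ρ₀ i) ~[ label root ] π (ρ₀ j)
        same i j (yes refl) = mk⇔ (λ a → contradiction a (Graph.~-irrefl G))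
                                  (λ a → contradiction a (Graph.~-irrefl (label root)))
        same i j (no i≢j)   = let adj = adjacent⇔ (ρ₀ i) (ρ₀ j) (λ eq → i≢j (inj eq)) in mk⇔
          (λ a → proj₂ (proj₂ (Equivalence.to adj a)))
          (λ a → Equivalence.from adj (all-open i , all-open j , a))

      reducible⊎embeds : Reducible (induced G f) ⊎ (Σ[ g ∈ Fin k ↣ Fin (size root) ]
        (∀ i j → i ~[ induced G f ] j ⇔ i ~[ induced (label root) g ] j))
      reducible⊎embeds
        with any? (λ i → any? (λ j → ¬? (i Fin.≟ j) ×-dec (π (ρ₀ i) Fin.≟ π (ρ₀ j))))
           | any? (λ i → ¬? (open? (ρ₀ i)))
      ... | yes (i , j , i≢j , eq) | _ =
        let d , len≤d = bounded (λ i → len (ρ₀ i))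
        in inj₁ (descend d ε ρ₀ i≢j eq tt λ l _ → len≤d l)
      ... | no none | yes (i , ¬oi)  =
        inj₁ (closed-isolated ρ₀ (λ {w} w≢i eq → none (i , w , (λ eq′ → w≢i (sym eq′)) , eq)) ¬oi)
      ... | no none | no none-closed = inj₂ (embed
        (λ {i} {j} eq → decidable-stable (i Fin.≟ j) λ i≢j → none (i , j , i≢j , eq))
        λ i → decidable-stable (open? (ρ₀ i)) λ ¬oi → none-closed (i , ¬oi))

-- Counting subsets

count : ∀ {n} {P : Pred (Subset n) 0ℓ} → Decidable P → ℕ
count {n} P? = length (filter P? (subsets n))

module _ {n : ℕ} {P Q : Pred (Subset n) 0ℓ} (P? : Decidable P) (Q? : Decidable Q) where

  count-mono : (∀ S → P S → Q S) → count P? ≤ count Q?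
  count-mono P⇒Q = length-mono-≤ (filter⁺ P? Q? (λ { refl → P⇒Q _ }) (⊆-refl {x = subsets n}))

length-filter-map : ∀ {A B : Set} {P : Pred B 0ℓ} (P? : Decidable P) (f : A → B) xs →
  length (filter P? (List.map f xs)) ≡ length (filter (P? ∘ f) xs)
length-filter-map P? f []       = refl
length-filter-map P? f (x ∷ xs) with does (P? (f x))
... | true  = cong suc (length-filter-map P? f xs)
... | false = length-filter-map P? f xs

length-filter-partition : ∀ {A : Set} {P Q : Pred A 0ℓ} (P? : Decidable P) (Q? : Decidable Q) xs →
  length (filter (λ x → P? x ×-dec Q? x) xs) + length (filter (λ x → P? x ×-dec ¬? (Q? x)) xs)
    ≡ length (filter P? xs)
length-filter-partition P? Q? []       = refl
length-filter-partition P? Q? (x ∷ xs) with does (P? x) | does (Q? x)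
... | false | _     = length-filter-partition P? Q? xs
... | true  | true  = cong suc (length-filter-partition P? Q? xs)
... | true  | false = trans (+-suc _ _) (cong suc (length-filter-partition P? Q? xs))

count-∷ : ∀ {n} {P : Pred (Subset (suc n)) 0ℓ} (P? : Decidable P) →
  count P? ≡ count (λ S → P? (outside ∷ S)) + count (λ S → P? (inside ∷ S))
count-∷ {n} P? = begin
  length (filter P? (outs ++ ins))                     ≡⟨ cong length (filter-++ P? outs ins) ⟩
  length (filter P? outs ++ filter P? ins)             ≡⟨ length-++ (filter P? outs) ⟩
  length (filter P? outs) + length (filter P? ins)     ≡⟨ cong₂ _+_ (length-filter-map P? _ (subsets n))
                                                                    (length-filter-map P? _ (subsets n)) ⟩
  _ ∎
  where
  open ≡-Reasoning
  outs = List.map (outside ∷_) (subsets n)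
  ins  = List.map (inside ∷_) (subsets n)

-- Induction on `x`: split by the first vertex, split both halves at `x`, and regroup the four
-- counts.
count-insertAt : ∀ {n} {P : Pred (Subset (suc n)) 0ℓ} (P? : Decidable P) (x : Fin (suc n)) →
  count P? ≡ count (λ S → P? (insertAt S x outside)) + count (λ S → P? (insertAt S x inside))
count-insertAt         P? zero    = count-∷ P?
count-insertAt {suc n} P? (suc x) = begin
  count P?
    ≡⟨ count-∷ P? ⟩
  count (λ S → P? (outside ∷ S)) + count (λ S → P? (inside ∷ S))
    ≡⟨ cong₂ _+_ (count-insertAt (λ S → P? (outside ∷ S)) x) (count-insertAt (λ S → P? (inside ∷ S)) x) ⟩
  (c outside outside + c outside inside) + (c inside outside + c inside inside)
    ≡⟨ interchange (c outside outside) (c outside inside) (c inside outside) (c inside inside) ⟩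
  (c outside outside + c inside outside) + (c outside inside + c inside inside)
    ≡⟨ cong₂ _+_ (count-∷ (λ S → P? (insertAt S (suc x) outside)))
                 (count-∷ (λ S → P? (insertAt S (suc x) inside))) ⟨
  count (λ S → P? (insertAt S (suc x) outside)) + count (λ S → P? (insertAt S (suc x) inside)) ∎
  where
  open ≡-Reasoning
  open import Algebra.Properties.CommutativeSemigroup ℕ.+-commutativeSemigroup using (interchange)
  c : Side → Side → ℕ
  c s t = count (λ S → P? (s ∷ insertAt S x t))

count-none : ∀ {n} {P : Pred (Subset n) 0ℓ} (P? : Decidable P) → (∀ S → ¬ P S) → count P? ≡ 0
count-none {n} P? ¬P = cong length (filter-none P? (All.universal ¬P (subsets n)))

count-avoiding : ∀ {n} {P : Pred (Subset (suc n)) 0ℓ} (P? : Decidable P) (x : Fin (suc n)) →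
  (∀ S → ¬ P (insertAt S x inside)) → count P? ≡ count (λ S → P? (insertAt S x outside))
count-avoiding P? x avoids = trans (count-insertAt P? x)
  (trans (cong (count (λ S → P? (insertAt S x outside)) +_) (count-none (λ S → P? (insertAt S x inside)) avoids)) (ℕ.+-identityʳ _))

∣insertAt-outside∣ : ∀ {n} (S : Subset n) x → ∣ insertAt S x outside ∣ ≡ ∣ S ∣
∣insertAt-outside∣ S             zero    = refl
∣insertAt-outside∣ (outside ∷ S) (suc x) = ∣insertAt-outside∣ S x
∣insertAt-outside∣ (inside ∷ S)  (suc x) = cong suc (∣insertAt-outside∣ S x)

∣insertAt-inside∣ : ∀ {n} (S : Subset n) x → ∣ insertAt S x inside ∣ ≡ suc ∣ S ∣
∣insertAt-inside∣ S             zero    = refl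
∣insertAt-inside∣ (outside ∷ S) (suc x) = ∣insertAt-inside∣ S x
∣insertAt-inside∣ (inside ∷ S)  (suc x) = cong suc (∣insertAt-inside∣ S x)

data InsertView {n} (x : Fin (suc n)) : Fin (suc n) → Set where
  new : InsertView x x
  old : ∀ j → InsertView x (punchIn x j)

insertView : ∀ {n} (x z : Fin (suc n)) → InsertView x z
insertView x z with x Fin.≟ z
... | yes refl = new
... | no x≢z   = subst (InsertView x) (punchIn-punchOut x≢z) (old (punchOut x≢z))

-- Failing sets and forts

Fails : ∀ {n} → Graph n → Subset n → Set
Fails G S = ¬ ZeroForcing G S

Failing : ∀ {n} → Graph n → ℕ → Subset n → Set
Failing G k S = ∣ S ∣ ≡ k × Fails G S

failing? : ∀ {n} (G : Graph n) k → Decidable (Failing G k)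
failing? G k S = (∣ S ∣ ℕ.≟ k) ×-dec ¬? (zeroForcing? G S)

ofSize : ∀ {n} k → Decidable {A = Subset n} (λ S → ∣ S ∣ ≡ k)
ofSize k S = ∣ S ∣ ℕ.≟ k

failures : ∀ {n} → Graph n → ℕ → ℕ
failures G k = count (failing? G k)

z+failures : ∀ {n} (G : Graph n) k → z G k + failures G k ≡ count {n} (ofSize k)
z+failures {n} G k = length-filter-partition (ofSize k) (zeroForcing? G) (subsets n)

-- For both graphs the two counts add up to the number of all sets of size `k`, which depends only
-- on `n`.
z≤⇒failures≥ : ∀ {n} (G H : Graph n) k → z G k ≤ z H k → failures H k ≤ failures G k
z≤⇒failures≥ G H k z≤ = ℕ.+-cancelˡ-≤ (z H k) _ _ (begin
  z H k + failures H k ≡⟨ trans (z+failures H k) (sym (z+failures G k)) ⟩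
  z G k + failures G k ≤⟨ ℕ.+-monoˡ-≤ _ z≤ ⟩
  z H k + failures G k ∎)
  where open ℕ.≤-Reasoning

failures≥⇒z≤ : ∀ {n} (G H : Graph n) k → failures H k ≤ failures G k → z G k ≤ z H k
failures≥⇒z≤ G H k f≤ = ℕ.+-cancelʳ-≤ (failures H k) _ _ (begin
  z G k + failures H k ≤⟨ ℕ.+-monoʳ-≤ _ f≤ ⟩
  z G k + failures G k ≡⟨ trans (z+failures G k) (sym (z+failures H k)) ⟩
  z H k + failures H k ∎)
  where open ℕ.≤-Reasoning

zeroForcing-resp : ∀ {n} (G H : Graph n) → (∀ u v → u ~[ G ] v ⇔ u ~[ H ] v) →
                   ∀ {S} → ZeroForcing G S → ZeroForcing H S
zeroForcing-resp G H same ε = ε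
zeroForcing-resp G H same ((u , v , (u∈S , v∉S , u~v , only) , eq) ◅ zf) =
  (u , v , (u∈S , v∉S , Equivalence.to (same u v) u~v ,
            λ w u~w → only w (Equivalence.from (same u w) u~w)) , eq)
  ◅ zeroForcing-resp G H same zf

Disjoint : ∀ {n} → Subset n → Pred (Fin n) 0ℓ → Set
Disjoint S W = ∀ {w} → W w → lookup S w ≡ outside

-- A set of white vertices into which no force is possible.
Fort : ∀ {n} → Graph n → Pred (Fin n) 0ℓ → Set
Fort G W = ∀ {a b} → W b → ¬ W a → a ~[ G ] b → ¬ (∀ w → a ~[ G ] w → W w → w ≡ b)

outside⇒∉ : ∀ {n} {S : Subset n} {w} → lookup S w ≡ outside → w ∉ S
outside⇒∉ eq w∈S with () ← trans (sym ([]=⇒lookup w∈S)) eq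

∉⇒outside : ∀ {n} {S : Subset n} {w} → w ∉ S → lookup S w ≡ outside
∉⇒outside {S = S} {w} w∉S with lookup S w in eq
... | outside = refl
... | inside  = contradiction (lookup⇒[]= w S eq) w∉S

-- Disjointness from `W` survives every force: the forcing vertex is blue, so outside `W`, and a
-- target in `W` would be its only neighbour there. The full set, however, contains `x`.
fort⇒fails : ∀ {n} (G : Graph n) {W : Pred (Fin n) 0ℓ} {x} → W x → Fort G W →
             ∀ {S} → Disjoint S W → Fails G S
fort⇒fails G {x = x} Wx fort disj ε = outside⇒∉ {S = full} (disj Wx) (∈⊤ {x = x})
fort⇒fails G {W} Wx fort {S} disj ((u , v , (u∈S , v∉S , u~v , only) , refl) ◅ zf) =
  fort⇒fails G {W} Wx fort disj′ zf
  where
  ¬Wv : ¬ W v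
  ¬Wv Wv = fort Wv (λ Wu → outside⇒∉ (disj Wu) u∈S) u~v
             λ w u~w Ww → only w u~w (outside⇒∉ (disj Ww))

  disj′ : Disjoint (S ∪ ⁅ v ⁆) W
  disj′ {w} Ww = ∉⇒outside λ w∈ → case (x∈p∪q⁻ S ⁅ v ⁆ w∈)
    where
    case : ¬ (w ∈ S ⊎ w ∈ ⁅ v ⁆)
    case (inj₁ w∈S) = outside⇒∉ (disj Ww) w∈S
    case (inj₂ w∈v) = ¬Wv (subst W (x∈⁅y⁆⇒x≡y v w∈v) Ww)

Stalled : ∀ {n} → Graph n → Subset n → Set
Stalled G F = ∀ {u v} → ¬ Forces G F u v

-- Force for as long as possible; reaching the full set would contradict failure.
fails⇒stalled : ∀ {n} (G : Graph n) {S} → Fails G S →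
                ∃[ F ] S ⊆ F × Stalled G F × F ≢ full
fails⇒stalled G {S} fails = go (⊃-wellFounded S) fails
  where
  go : ∀ {S} → Acc _⊃_ S → Fails G S → ∃[ F ] S ⊆ F × Stalled G F × F ≢ full
  go {S} (acc rec) fails with any? (λ u → any? (λ v → forces? G S u v))
  ... | no stalled = S , (λ x∈S → x∈S) , (λ {u} {v} f → stalled (u , v , f)) , λ { refl → fails ε }
  ... | yes (u , v , f) =
    let F , S∪v⊆F , rest = go (rec (p⊆p∪q ⁅ v ⁆ , v , q⊆p∪q S ⁅ v ⁆ (x∈⁅x⁆ v) , proj₁ (proj₂ f)))
                              (λ zf → fails ((u , v , f , refl) ◅ zf))
    in F , (λ x∈S → S∪v⊆F (p⊆p∪q ⁅ v ⁆ x∈S)) , rest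

stalled⇒fort : ∀ {n} (G : Graph n) {F} → Stalled G F → Fort G (_∉ F)
stalled⇒fort G {F} stalled {a} b∉F ¬a∉F a~b only =
  stalled (decidable-stable (a ∈? F) ¬a∉F , b∉F , a~b , only)

proper⇒∉ : ∀ {n} (F : Subset n) → F ≢ full → ∃[ w ] w ∉ F
proper⇒∉ []            F≢ = contradiction refl F≢
proper⇒∉ (outside ∷ F) F≢ = zero , λ ()
proper⇒∉ (inside ∷ F)  F≢ =
  let w , w∉F = proper⇒∉ F (λ eq → F≢ (cong (inside ∷_) eq))
  in suc w , λ w∈ → w∉F (drop-there w∈)

-- Converse of `fort⇒fails`: the vertices that stay white form the fort.
fails⇒fort : ∀ {n} (G : Graph n) {S} → Fails G S →
             Σ[ W ∈ Pred (Fin n) 0ℓ ] (∃[ x ] W x) × Fort G W × Disjoint S W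
fails⇒fort G fails =
  let F , S⊆F , stalled , F≢ = fails⇒stalled G fails
  in (_∉ F) , proper⇒∉ F F≢ , stalled⇒fort G stalled , λ w∉F → ∉⇒outside λ w∈S → w∉F (S⊆F w∈S)

-- Failing sets of paths

-- Every sparse set starts with `outside`, so the remainder after `blue` supplies the white
-- successor. The base is a single white vertex: on zero vertices the empty set is full and does not
-- fail.
data Sparse : ∀ {n} → Subset n → Set where
  end   : Sparse (outside ∷ [])
  white : ∀ {n} {S : Subset n} → Sparse S → Sparse (outside ∷ S)
  blue  : ∀ {n} {S : Subset n} → Sparse S → Sparse (outside ∷ inside ∷ S)

sparse? : ∀ {n} → Decidable (Sparse {n})
sparse? []                          = no λ ()
sparse? (inside ∷ S)                = no λ ()
sparse? (outside ∷ [])              = yes end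
sparse? (outside ∷ inside ∷ S)      = map′ blue (λ { (white ()) ; (blue s) → s }) (sparse? S)
sparse? (outside ∷ S@(outside ∷ _)) = map′ white (λ { (white s) → s }) (sparse? S)

sparse-⊆ : ∀ {n} {F S : Subset n} → S ⊆ F → Sparse F → Sparse S
sparse-⊆ {S = outside ∷ []}          S⊆F end       = end
sparse-⊆ {S = outside ∷ _}           S⊆F (white s) = white (sparse-⊆ (drop-there ∘ S⊆F ∘ there) s)
sparse-⊆ {S = outside ∷ inside ∷ _}  S⊆F (blue s)  =
  blue (sparse-⊆ (drop-there ∘ drop-there ∘ S⊆F ∘ there ∘ there) s)
sparse-⊆ {S = outside ∷ outside ∷ _} S⊆F (blue s)  =
  white (white (sparse-⊆ (drop-there ∘ drop-there ∘ S⊆F ∘ there ∘ there) s))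
sparse-⊆ {S = inside ∷ _}            S⊆F end       with () ← S⊆F here
sparse-⊆ {S = inside ∷ _}            S⊆F (white _) with () ← S⊆F here
sparse-⊆ {S = inside ∷ _}            S⊆F (blue _)  with () ← S⊆F here

sparse-zero : ∀ {n} {S : Subset n} → Sparse S → Σ[ x ∈ Fin n ] toℕ x ≡ 0 × x ∉ S
sparse-zero end       = zero , refl , λ ()
sparse-zero (white _) = zero , refl , λ ()
sparse-zero (blue _)  = zero , refl , λ ()

sparse-neighbours : ∀ {n} {S : Subset n} {u} → Sparse S → u ∈ S →
  ∃[ a ] ∃[ b ] suc (toℕ a) ≡ toℕ u × suc (toℕ u) ≡ toℕ b × a ∉ S × b ∉ S
sparse-neighbours (white s) (there u∈) =
  let a , b , a≡ , b≡ , a∉ , b∉ = sparse-neighbours s u∈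
  in suc a , suc b , cong suc a≡ , cong suc b≡ , a∉ ∘ drop-there , b∉ ∘ drop-there
sparse-neighbours (blue s) (there here) =
  let b , b≡0 , b∉ = sparse-zero s
  in zero , suc (suc b) , refl , cong suc (cong suc (sym b≡0)) , (λ ()) , b∉ ∘ drop-there ∘ drop-there
sparse-neighbours (blue s) (there (there u∈)) =
  let a , b , a≡ , b≡ , a∉ , b∉ = sparse-neighbours s u∈
  in suc (suc a) , suc (suc b) , cong suc (cong suc a≡) , cong suc (cong suc b≡) ,
     a∉ ∘ drop-there ∘ drop-there , b∉ ∘ drop-there ∘ drop-there

path-edge⇔ : ∀ {n} {i j : Fin n} → i ~[ pathGraph n ] j ⇔ Consecutive i j
path-edge⇔ {n} {i} {j} = mk⇔ toWitness fromWitness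

-- Each blue vertex has a white predecessor and a white successor, so no force is possible at all.
sparse⇒fails : ∀ {n} {S : Subset n} → Sparse S → Fails (pathGraph n) S
sparse⇒fails {n} {S} s =
  fort⇒fails (pathGraph n) {W = _∉ S} (proj₂ (proj₂ (sparse-zero s)))
    (stalled⇒fort (pathGraph n) stalled) (λ w∉S → ∉⇒outside w∉S)
  where
  open Equivalence
  stalled : Stalled (pathGraph n) S
  stalled (u∈ , _ , _ , only) with sparse-neighbours s u∈
  ... | a , b , a≡ , b≡ , a∉ , b∉
    with refl ← trans (only a (from path-edge⇔ (inj₂ a≡)) a∉) (sym (only b (from path-edge⇔ (inj₁ b≡)) b∉))
    with () ← ℕ.<⇒≢ (s≤s (ℕ.n≤1+n _)) (sym (trans (cong suc a≡) b≡))

-- Prepending a vertex spoils a force only if it is a new white neighbour of `u`, that is, if it is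
-- white and `u` was the first vertex.
forces-∷ : ∀ {n s} {F : Subset n} {u v} → s ≡ inside ⊎ toℕ u ≢ 0 →
  Forces (pathGraph n) F u v → Forces (pathGraph (suc n)) (s ∷ F) (suc u) (suc v)
forces-∷ {n} {s} {F} {u} {v} safe (u∈ , v∉ , u~v , only) =
  (there u∈ , v∉ ∘ drop-there , from path-edge⇔ (up (to path-edge⇔ u~v)) , only′)
  where
  open Equivalence
  up : ∀ {n} {i j : Fin n} → Consecutive i j → Consecutive (suc i) (suc j)
  up (inj₁ eq) = inj₁ (cong suc eq)
  up (inj₂ eq) = inj₂ (cong suc eq)

  down : ∀ {n} {i j : Fin n} → Consecutive (suc i) (suc j) → Consecutive i j
  down (inj₁ eq) = inj₁ (suc-injective eq)
  down (inj₂ eq) = inj₂ (suc-injective eq)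

  zero-blue : s ≡ inside ⊎ toℕ u ≢ 0 → Consecutive (suc u) (zero {n}) → zero ∈ s ∷ F
  zero-blue (inj₁ refl)  _         = here
  zero-blue (inj₂ u≢0)   (inj₂ eq) = contradiction (sym (suc-injective eq)) u≢0

  only′ : ∀ w → suc u ~[ pathGraph _ ] w → w ∉ s ∷ F → w ≡ suc v
  only′ (suc w) u~w w∉ = cong suc (only w (from path-edge⇔ (down (to path-edge⇔ u~w))) (w∉ ∘ there))
  only′ zero    u~0 0∉ = contradiction (zero-blue safe (to path-edge⇔ u~0)) 0∉

-- A blue end has a single neighbour, which it forces if white; so in a stalled set blue spreads
-- along the whole path.
stalled-inside : ∀ {n} {F : Subset n} → Stalled (pathGraph (suc n)) (inside ∷ F) → F ≡ full
stalled-inside {F = []}          stalled = refl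
stalled-inside {F = inside ∷ F}  stalled =
  cong (inside ∷_) (stalled-inside (stalled ∘ forces-∷ (inj₁ refl)))
stalled-inside {F = outside ∷ F} stalled =
  contradiction (here , (λ { (there ()) }) , tt , only) (stalled {zero} {suc zero})
  where
  only : ∀ w → zero ~[ pathGraph _ ] w → w ∉ inside ∷ outside ∷ F → w ≡ suc zero
  only w 0~w _ with Equivalence.to (path-edge⇔ {i = zero} {j = w}) 0~w
  ... | inj₁ eq = toℕ-injective (sym eq)

-- The first vertex is white by `stalled-inside`. If the second is blue, the third must exist and be
-- white, or the second would force the first. The remainder is stalled again by `forces-∷`.
stalled⇒sparse : ∀ {n} {F : Subset n} → Stalled (pathGraph n) F → F ≢ full → Sparse F
stalled⇒sparse {F = []}                    stalled F≢ = contradiction refl F≢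
stalled⇒sparse {F = inside ∷ F}            stalled F≢ =
  contradiction (cong (inside ∷_) (stalled-inside stalled)) F≢
stalled⇒sparse {F = outside ∷ []}          stalled F≢ = end
stalled⇒sparse {F = outside ∷ outside ∷ F} stalled F≢ =
  white (stalled⇒sparse (λ { f@(there _ , _) → stalled (forces-∷ (inj₂ λ ()) f) }) λ ())
stalled⇒sparse {F = outside ∷ inside ∷ []} stalled F≢ =
  contradiction (there here , (λ ()) , tt , λ { zero _ _ → refl ; (suc zero) () }) (stalled {suc zero} {zero})
stalled⇒sparse {F = outside ∷ inside ∷ inside ∷ F} stalled F≢ =
  contradiction (there here , (λ ()) , tt , only) (stalled {suc zero} {zero})
  where
  only : ∀ w → suc zero ~[ pathGraph _ ] w → w ∉ outside ∷ inside ∷ inside ∷ F → w ≡ zero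
  only zero          _   _  = refl
  only (suc zero)    ()
  only (suc (suc w)) 1~w w∉ with Equivalence.to (path-edge⇔ {i = suc zero} {j = suc (suc w)}) 1~w
  ... | inj₁ eq with refl ← toℕ-injective {i = zero} {j = w} (suc-injective (suc-injective eq)) =
    contradiction (there (there here)) w∉
stalled⇒sparse {F = outside ∷ inside ∷ outside ∷ F} stalled F≢ =
  blue (stalled⇒sparse (λ { f@(there _ , _) → stalled (forces-∷ (inj₂ λ ()) (forces-∷ (inj₁ refl) f)) }) λ ())

sparse-last : ∀ {n} {S : Subset (suc n)} → Sparse S → lookup S (fromℕ n) ≡ outside
sparse-last end                           = refl
sparse-last {suc n} (white s)             = sparse-last s
sparse-last {suc (suc n)} (blue s)        = sparse-last s

sparseOfSize? : ∀ {n} k → Decidable {A = Subset n} (λ S → ∣ S ∣ ≡ k × Sparse S)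
sparseOfSize? k S = (∣ S ∣ ℕ.≟ k) ×-dec sparse? S

sparseCount : ℕ → ℕ → ℕ
sparseCount n k = count {n} (sparseOfSize? k)

failures-path≤sparseCount : ∀ n k → failures (pathGraph n) k ≤ sparseCount n k
failures-path≤sparseCount n k = count-mono (failing? (pathGraph n) k) (sparseOfSize? k)
  λ S (size , fails) →
    let F , S⊆F , stalled , F≢ = fails⇒stalled (pathGraph n) fails
    in size , sparse-⊆ S⊆F (stalled⇒sparse stalled F≢)

sparseCount≤failures-path : ∀ n k → sparseCount n k ≤ failures (pathGraph n) k
sparseCount≤failures-path n k = count-mono (sparseOfSize? k) (failing? (pathGraph n) k)
  λ S (size , sparse) → size , sparse⇒fails sparse

sparseCount-suc : ∀ n k →
  sparseCount (suc n) k ≡ count {n} (λ S → sparseOfSize? k (outside ∷ S))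
sparseCount-suc n k = count-avoiding {n} (sparseOfSize? k) zero λ { _ (_ , ()) }

sparseCount-suc≤ : ∀ n k → sparseCount (suc n) k ≤ count {n} (ofSize k)
sparseCount-suc≤ n k = ≤-trans (≤-reflexive (sparseCount-suc n k))
  (count-mono {n} (λ S → sparseOfSize? k (outside ∷ S)) (ofSize k) λ _ → proj₁)

-- Both ends of the path lie outside a sparse set, just as the failing sets found for twins avoid
-- two given vertices.
sparseCount-suc-suc≤ : ∀ n k → sparseCount (suc (suc n)) k ≤ count {n} (ofSize k)
sparseCount-suc-suc≤ n k = begin
  sparseCount (suc (suc n)) k
    ≡⟨ sparseCount-suc (suc n) k ⟩
  count {suc n} (λ S → sparseOfSize? k (outside ∷ S))
    ≡⟨ count-avoiding (λ S → sparseOfSize? k (outside ∷ S)) (fromℕ n) last-blue ⟩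
  count {n} (λ S → sparseOfSize? k (outside ∷ insertAt S (fromℕ n) outside))
    ≤⟨ count-mono (λ S → sparseOfSize? k (outside ∷ insertAt S (fromℕ n) outside)) (ofSize k)
         (λ S (size , _) → trans (sym (∣insertAt-outside∣ S (fromℕ n))) size) ⟩
  count {n} (ofSize k) ∎
  where
  open ℕ.≤-Reasoning
  last-blue : ∀ S → ¬ (∣ outside ∷ insertAt S (fromℕ n) inside ∣ ≡ k ×
                       Sparse (outside ∷ insertAt S (fromℕ n) inside))
  last-blue S (_ , s) with () ← trans (sym (insertAt-lookup S (fromℕ n) inside)) (sparse-last s)

-- Split by the second vertex: if it is white, dropping the first leaves a sparse set. The other
-- summand keeps its two leading vertices, which avoids a predecessor of `k`.
sparseCount-recurrence : ∀ n k → sparseCount (suc (suc n)) k ≤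
  sparseCount (suc n) k + count {n} (λ S → sparseOfSize? k (outside ∷ inside ∷ S))
sparseCount-recurrence n k = begin
  sparseCount (suc (suc n)) k
    ≡⟨ sparseCount-suc (suc n) k ⟩
  count {suc n} (λ S → sparseOfSize? k (outside ∷ S))
    ≡⟨ count-∷ {n} (λ S → sparseOfSize? k (outside ∷ S)) ⟩
  count {n} (λ S → sparseOfSize? k (outside ∷ outside ∷ S)) + blues
    ≤⟨ ℕ.+-monoˡ-≤ blues (count-mono {n} (λ S → sparseOfSize? k (outside ∷ outside ∷ S))
         (λ S → sparseOfSize? k (outside ∷ S)) λ { _ (size , white s) → size , s }) ⟩
  count {n} (λ S → sparseOfSize? k (outside ∷ S)) + blues
    ≡⟨ cong (_+ blues) (sparseCount-suc n k) ⟨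
  sparseCount (suc n) k + blues ∎
  where
  open ℕ.≤-Reasoning
  blues : ℕ
  blues = count {n} (λ S → sparseOfSize? k (outside ∷ inside ∷ S))

-- Isolated vertices, twins and leaves

SparseBound : ∀ {n} → Graph n → Set
SparseBound {n} G = ∀ k → sparseCount n k ≤ failures G k

-- The single vertex `u` is a fort, so every set avoiding it fails.
isolated-bound : ∀ {n} (G : Graph n) {u} → (∀ v → ¬ (u ~[ G ] v)) → SparseBound G
isolated-bound {suc n} G {u} alone k = begin
  sparseCount (suc n) k ≤⟨ sparseCount-suc≤ n k ⟩
  count {n} (ofSize k)
    ≤⟨ count-mono (ofSize k) (λ S → failing? G k (insertAt S u outside)) (λ S size →
         trans (∣insertAt-outside∣ S u) size ,
         fort⇒fails G {W = _≡ u} refl fort λ { refl → insertAt-lookup S u outside }) ⟩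
  count (λ S → failing? G k (insertAt S u outside))
    ≤⟨ m≤m+n _ _ ⟩
  _ ≡⟨ count-insertAt (failing? G k) u ⟨
  failures G k ∎
  where
  open ℕ.≤-Reasoning
  fort : Fort G (_≡ u)
  fort refl _ a~u _ = alone _ (Graph.~-sym G a~u)

-- The pair `u`, `v` is a fort: an outside vertex adjacent to one of them is adjacent to both.
twins-bound : ∀ {n} (G : Graph n) {u v} → u ≢ v →
  (∀ {w} → w ≢ u → w ≢ v → u ~[ G ] w ⇔ v ~[ G ] w) → SparseBound G
twins-bound {suc zero}    G {zero} {zero} u≢v same = contradiction refl u≢v
twins-bound {suc (suc n)} G {u} {v} u≢v same k = begin
  sparseCount (suc (suc n)) k ≤⟨ sparseCount-suc-suc≤ n k ⟩
  count {n} (ofSize k)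
    ≤⟨ count-mono (ofSize k) (λ S → failing? G k (insertAt (insertAt S v′ outside) u outside)) (λ S size →
         trans (∣insertAt-outside∣ (insertAt S v′ outside) u) (trans (∣insertAt-outside∣ S v′) size) ,
         fort⇒fails G {W = W} (inj₁ refl) fort (disj S)) ⟩
  count (λ S → failing? G k (insertAt (insertAt S v′ outside) u outside))
    ≤⟨ m≤m+n _ _ ⟩
  _ ≡⟨ count-insertAt (λ S → failing? G k (insertAt S u outside)) v′ ⟨
  count (λ S → failing? G k (insertAt S u outside))
    ≤⟨ m≤m+n _ _ ⟩
  _ ≡⟨ count-insertAt (failing? G k) u ⟨
  failures G k ∎
  where
  open ℕ.≤-Reasoning
  v′ : Fin (suc n)
  v′ = punchOut u≢v

  W : Pred (Fin (suc (suc n))) 0ℓ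
  W w = w ≡ u ⊎ w ≡ v

  fort : Fort G W
  fort (inj₁ refl) ¬Wa a~u only = u≢v (sym (only v (Graph.~-sym G
    (Equivalence.to (same (¬Wa ∘ inj₁) (¬Wa ∘ inj₂)) (Graph.~-sym G a~u))) (inj₂ refl)))
  fort (inj₂ refl) ¬Wa a~v only = u≢v (only u (Graph.~-sym G
    (Equivalence.from (same (¬Wa ∘ inj₁) (¬Wa ∘ inj₂)) (Graph.~-sym G a~v))) (inj₁ refl))

  disj : ∀ S → Disjoint (insertAt (insertAt S v′ outside) u outside) W
  disj S (inj₁ refl) = insertAt-lookup _ u outside
  disj S (inj₂ refl) = subst (λ w → lookup (insertAt (insertAt S v′ outside) u outside) w ≡ outside)
    (punchIn-punchOut u≢v)
    (trans (insertAt-punchIn _ u outside v′) (insertAt-lookup S v′ outside))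

punchIn↣ : ∀ {n} → Fin (suc n) → Fin n ↣ Fin (suc n)
punchIn↣ x = mk↣ {to = punchIn x} (punchIn-injective x _ _)

delete : ∀ {n} → Graph (suc n) → Fin (suc n) → Graph n
delete G x = induced G (punchIn↣ x)

module _ {n : ℕ} (G : Graph (suc (suc n))) (x : Fin (suc (suc n))) (y : Fin (suc n))
         (x~y : x ~[ G ] punchIn x y) (only-y : ∀ {v} → x ~[ G ] v → v ≡ punchIn x y) where

  private
    G-x : Graph (suc n)
    G-x = delete G x

    G-x-y : Graph n
    G-x-y = delete G-x y

    set : Side → Side → Subset n → Subset (suc (suc n))
    set s t U = insertAt (insertAt U y t) x s

    y-only : ∀ {v} → v ~[ G ] x → v ≡ punchIn x y
    y-only v~x = only-y (Graph.~-sym G v~x)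

  -- The sets without y; reading x as y makes them subsets of G - x.
  fails-delete-leaf : ∀ s U → Fails G-x (insertAt U y s) → Fails G (set s outside U)
  fails-delete-leaf s U fails with fails⇒fort G-x fails
  ... | W′ , (z , W′z) , fort′ , disj′ = fort⇒fails G {W = W} (inj₁ (z , refl , W′z)) fort disj
    where
    -- The leaf `x` joins the fort exactly when `y` is in it, so neither of them can force the other
    -- from outside.
    W : Pred (Fin (suc (suc n))) 0ℓ
    W w = (∃[ j ] w ≡ punchIn x j × W′ j) ⊎ (w ≡ x × W′ y)

    fort : Fort G W
    fort {a} (inj₂ (refl , W′y)) ¬Wa a~x only = ¬Wa (inj₁ (y , y-only a~x , W′y))
    fort {a} (inj₁ (j , refl , W′j)) ¬Wa a~b only with insertView x a
    ... | new   = ¬Wa (inj₂ (refl , subst W′ (punchIn-injective x _ _ (only-y a~b)) W′j))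
    ... | old i = fort′ W′j (λ W′i → ¬Wa (inj₁ (i , refl , W′i))) a~b
      λ w i~w W′w → punchIn-injective x _ _ (only (punchIn x w) i~w (inj₁ (w , refl , W′w)))

    disj : Disjoint (set s outside U) W
    disj (inj₂ (refl , W′y)) =
      trans (insertAt-lookup _ x s) (trans (sym (insertAt-lookup U y s)) (disj′ W′y))
    disj (inj₁ (j , refl , W′j)) with insertView y j
    ... | new   = trans (insertAt-punchIn _ x s y) (insertAt-lookup U y outside)
    ... | old i = trans (insertAt-punchIn _ x s (punchIn y i)) (trans (insertAt-punchIn U y outside i)
      (trans (sym (insertAt-punchIn U y s i)) (disj′ W′j)))

  -- The sets with `y` but without `x`; removing both vertices lowers their size by one.
  fails-delete-pair : ∀ U → Fails G-x-y U → Fails G (set outside inside U)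
  fails-delete-pair U fails with fails⇒fort G-x-y fails
  ... | W′ , (z , W′z) , fort′ , disj′ = fort⇒fails G {W = W} (inj₁ (z , refl , W′z)) fort disj
    where
    embed : Fin n → Fin (suc (suc n))
    embed j = punchIn x (punchIn y j)

    -- x joins exactly when y has a neighbour in W′: then y sees at least two vertices
    -- of the fort, and otherwise none, so it never forces into it.
    W : Pred (Fin (suc (suc n))) 0ℓ
    W w = (∃[ j ] w ≡ embed j × W′ j) ⊎ (w ≡ x × ∃[ j ] punchIn x y ~[ G ] embed j × W′ j)

    embed≢x : ∀ j → embed j ≢ x
    embed≢x j = punchInᵢ≢i x (punchIn y j)

    embed≢y : ∀ j → embed j ≢ punchIn x y
    embed≢y j eq = punchInᵢ≢i y j (punchIn-injective x _ _ eq)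

    fort : Fort G W
    fort (inj₂ (refl , j , y~j , W′j)) ¬Wa a~x only with refl ← y-only a~x =
      embed≢x j (only (embed j) y~j (inj₁ (j , refl , W′j)))
    fort {a} (inj₁ (j , refl , W′j)) ¬Wa a~b only with insertView x a
    ... | new   = embed≢y j (only-y a~b)
    ... | old i with insertView y i
    ...   | new    = embed≢x j (sym (only x (Graph.~-sym G x~y) (inj₂ (refl , j , a~b , W′j))))
    ...   | old i′ = fort′ W′j (λ W′i → ¬Wa (inj₁ (i′ , refl , W′i))) a~b
      λ w i~w W′w → punchIn-injective y _ _ (punchIn-injective x _ _
        (only (embed w) i~w (inj₁ (w , refl , W′w))))

    disj : Disjoint (set outside inside U) W
    disj (inj₂ (refl , _)) = insertAt-lookup _ x outside
    disj (inj₁ (j , refl , W′j)) =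
      trans (insertAt-punchIn _ x outside (punchIn y j)) (trans (insertAt-punchIn U y inside j) (disj′ W′j))

  ∣set-outside∣ : ∀ s U → ∣ set s outside U ∣ ≡ ∣ insertAt U y s ∣
  ∣set-outside∣ outside U = trans (∣insertAt-outside∣ _ x)
    (trans (∣insertAt-outside∣ U y) (sym (∣insertAt-outside∣ U y)))
  ∣set-outside∣ inside  U = trans (∣insertAt-inside∣ _ x)
    (trans (cong suc (∣insertAt-outside∣ U y)) (sym (∣insertAt-inside∣ U y)))

  -- Of the four classes of sets, by the colours of `x` and `y`, the two with `y` white account for
  -- `G-x`, the one with only `y` blue is the second summand, and the last is dropped.
  failures-pendant : ∀ k → failures G-x k + count (λ U → failing? G k (set outside inside U)) ≤ failures G k
  failures-pendant k = begin
    failures G-x k + g outside inside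
      ≡⟨ cong (_+ g outside inside) (count-insertAt (failing? G-x k) y) ⟩
    (h outside + h inside) + g outside inside
      ≤⟨ +-mono-≤ (+-mono-≤ (h≤g outside) (h≤g inside)) (≤-refl {g outside inside}) ⟩
    (g outside outside + g inside outside) + g outside inside
      ≡⟨ trans (+-assoc (g outside outside) _ _)
               (trans (cong (g outside outside +_) (+-comm (g inside outside) _)) (sym (+-assoc (g outside outside) _ _))) ⟩
    (g outside outside + g outside inside) + g inside outside
      ≤⟨ ℕ.+-monoʳ-≤ (g outside outside + g outside inside) (m≤m+n (g inside outside) (g inside inside)) ⟩
    (g outside outside + g outside inside) + (g inside outside + g inside inside)
      ≡⟨ cong₂ _+_ (count-insertAt (λ S → failing? G k (insertAt S x outside)) y)
                   (count-insertAt (λ S → failing? G k (insertAt S x inside)) y) ⟨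
    count (λ S → failing? G k (insertAt S x outside)) + count (λ S → failing? G k (insertAt S x inside))
      ≡⟨ count-insertAt (failing? G k) x ⟨
    failures G k ∎
    where
    open ℕ.≤-Reasoning
    g : Side → Side → ℕ
    g s t = count (λ U → failing? G k (set s t U))

    h : Side → ℕ
    h s = count (λ U → failing? G-x k (insertAt U y s))

    h≤g : ∀ s → h s ≤ g s outside
    h≤g s = count-mono (λ U → failing? G-x k (insertAt U y s)) (λ U → failing? G k (set s outside U))
      λ U (size , fails) → trans (∣set-outside∣ s U) size , fails-delete-leaf s U fails

  pendant-bound : SparseBound G-x → SparseBound G-x-y → SparseBound G
  pendant-bound bound₁ bound₂ k = begin
    sparseCount (suc (suc n)) k
      ≤⟨ sparseCount-recurrence n k ⟩
    sparseCount (suc n) k + count {n} (λ S → sparseOfSize? k (outside ∷ inside ∷ S))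
      ≤⟨ +-mono-≤ (bound₁ k) (blues k) ⟩
    failures G-x k + count (λ U → failing? G k (set outside inside U))
      ≤⟨ failures-pendant k ⟩
    failures G k ∎
    where
    open ℕ.≤-Reasoning
    blues : ∀ k → count {n} (λ S → sparseOfSize? k (outside ∷ inside ∷ S)) ≤
                  count (λ U → failing? G k (set outside inside U))
    -- A set with a blue second vertex is not empty.
    blues zero = ≤-trans (≤-reflexive (count-none {n} (λ S → sparseOfSize? 0 (outside ∷ inside ∷ S)) λ { _ (() , _) })) z≤n
    blues (suc k) = begin
      count {n} (λ S → sparseOfSize? (suc k) (outside ∷ inside ∷ S))
        ≤⟨ count-mono {n} (λ S → sparseOfSize? (suc k) (outside ∷ inside ∷ S)) (sparseOfSize? k)
             (λ { _ (size , blue s) → suc-injective size , s ; _ (_ , white ()) }) ⟩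
      sparseCount n k
        ≤⟨ bound₂ k ⟩
      failures G-x-y k
        ≤⟨ count-mono (failing? G-x-y k) (λ U → failing? G (suc k) (set outside inside U))
             (λ U (size , fails) →
               trans (∣insertAt-outside∣ _ x) (trans (∣insertAt-inside∣ U y) (cong suc size)) ,
               fails-delete-pair U fails) ⟩
      count (λ U → failing? G (suc k) (set outside inside U)) ∎

-- Induction over the induced subgraphs

corollary4 : ∀ (m : ℕ) →
    (∀ {n} (H : Graph n) → n ≤ m → SplitPrime H →
    ∀ {k} (f : Fin k ↣ Fin n) → PathExtremal (induced H f)) →
    ∀ {n} (G : Graph n) → InClass m G → PathExtremal G
corollary4 m hyp {n} G inClass k _ = failures≥⇒z≤ G (pathGraph n) k
  (≤-trans (failures-path≤sparseCount n k) (bound n (↣-id (Fin n)) k))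
  where
  open InClass inClass
  open Reduced reduced
  open Decomposition represents

  basic : ∀ {B} → B ≢ prime → BasicBag B
  basic {B} B≢ with bag-kinds B
  ... | inj₁ (_ , clique)      = inj₁ clique
  ... | inj₂ (inj₁ (_ , star)) = inj₂ star
  ... | inj₂ (inj₂ is-prime)   = contradiction (prime-unique B is-prime) B≢

  mutual
    bound : ∀ k (f : Fin k ↣ Fin n) → SparseBound (induced G f)
    bound k f with Subgraph.Descent.reducible⊎embeds f prime basic
    ... | inj₁ reducible  = reduce k f reducible
    ... | inj₂ (g , same) = λ j → embedded g same j (j ℕ.≤? k)
      where
      open GraphLabelledTree decomposition using (label; size)
      embedded : (g : Fin k ↣ Fin (size prime)) →
        (∀ u v → u ~[ induced G f ] v ⇔ u ~[ induced (label prime) g ] v) →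
        ∀ j → Dec (j ≤ k) → sparseCount k j ≤ failures (induced G f) j
      embedded g same j (yes j≤k) = begin
        sparseCount k j
          ≤⟨ sparseCount≤failures-path k j ⟩
        failures (pathGraph k) j
          ≤⟨ z≤⇒failures≥ (induced (label prime) g) (pathGraph k) j
               (hyp (label prime) prime-size prime-is-prime g j j≤k) ⟩
        failures (induced (label prime) g) j
          ≤⟨ count-mono (failing? (induced (label prime) g) j) (failing? (induced G f) j)
               (λ S (size , fails) → size ,
                 fails ∘ zeroForcing-resp (induced G f) (induced (label prime) g) same) ⟩
        failures (induced G f) j ∎
        where open ℕ.≤-Reasoning
      -- Path-extremality speaks only of sizes up to `k`; beyond that there are no sets to count.
      embedded g same j (no j≰k) = count-mono (sparseOfSize? j) (failing? (induced G f) j)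
        λ { S (refl , _) → contradiction (∣p∣≤n S) j≰k }

    reduce : ∀ k (f : Fin k ↣ Fin n) → Reducible (induced G f) → SparseBound (induced G f)
    reduce k f (isolated u alone) = isolated-bound (induced G f) alone
    reduce k f (twins u≢v same)   = twins-bound (induced G f) u≢v same
    reduce (suc zero) f (pendant {zero} {zero} x~y _) =
      contradiction x~y (Graph.~-irrefl (induced G f) {zero})
    reduce (suc (suc k)) f (pendant {x} {y} x~y only) =
      -- Deleting vertices amounts to composing `f` with `punchIn↣`, so both smaller graphs are
      -- again induced subgraphs of `G`.
      pendant-bound (induced G f) x (punchOut x≢y)
        (subst (λ v → x ~[ induced G f ] v) y≡ x~y) (λ a → trans (only a) y≡)
        (bound (suc k) (f ↣-∘ punchIn↣ x))
        (bound k ((f ↣-∘ punchIn↣ x) ↣-∘ punchIn↣ (punchOut x≢y)))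
      where
      x≢y : x ≢ y
      x≢y refl = Graph.~-irrefl (induced G f) {x} x~y

      y≡ : y ≡ punchIn x (punchOut x≢y)
      y≡ = sym (punchIn-punchOut x≢y)
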